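{- For every integer $n\ge 2$, the set of lower accumulation points for $n$ runners contains $\mathcal{S}(n-1)$.
   Context: For a real number $x$, $\Vert x\Vert$ denotes the distance from $x$ to the nearest integer. For positive integers $v_1,\ldots,v_n$, $\mathrm{ML}(v_1,\ldots,v_n)=\max_{t\in\mathbb{R}}\min_{1\le i\le n}\Vert t v_i\Vert$. Let $\mathcal{S}(n)=\{\mathrm{ML}(v_1,\ldots,v_n): v_1,\ldots,v_n \text{ positive integers}\}$. A real number $A$ is a lower accumulation point for $n$ runners if $\mathcal{S}(n)$ contains a sequence of elements strictly less than $A$ converging to $A$. -}

module Defs where

open import Data.Bool.Base using (true; false)
open import Data.Empty using (⊥)
open import Data.Fin.Base using (Fin; zero; suc)
open import Data.Integer.Base as ℤ using (ℤ; +_)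
import Data.Integer.DivMod as ℤ
import Data.Integer.Properties as ℤ
open import Data.Nat.Base as ℕ using (ℕ; zero; suc)
import Data.Nat.Properties as ℕ
open import Data.Product.Base using (∃-syntax; Σ-syntax; _×_; _,_; proj₁; proj₂)
open import Data.Rational.Base as ℚ using (ℚ; mkℚ; 0ℚ; 1ℚ; ½; toℚᵘ)
import Data.Rational.Properties as ℚ
open import Data.Rational.Solver using (module +-*-Solver)
open import Data.Rational.Unnormalised.Base as ℚᵘ using (mkℚᵘ)
import Data.Rational.Unnormalised.Properties as ℚᵘ
open import Data.Sum.Base using (inj₁; inj₂)
open import Level using (0ℓ)
open import Relation.Binary.Core using (Rel)
open import Relation.Binary.Definitions using (tri<; tri≈; tri>)
open import Relation.Binary.PropositionalEquality using (_≡_; refl; sym; trans; cong; cong₂; subst; subst₂)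
open import Relation.Unary using (Pred)

open +-*-Solver using (solve; _:=_; _:+_; _:*_; _:-_; :-_; con)

fromℤ : ℤ → ℚ
fromℤ i = i ℚ./ 1

fromℕ : ℕ → ℚ
fromℕ n = fromℤ (+ n)

∣-∣-lub : ∀ {p r} → p ℚ.≤ r → ℚ.- p ℚ.≤ r → ℚ.∣ p ∣ ℚ.≤ r
∣-∣-lub {p} p≤r -p≤r with ℚ.∣p∣≡p∨∣p∣≡-p p
... | inj₁ eq = subst (ℚ._≤ _) (sym eq) p≤r
... | inj₂ eq = subst (ℚ._≤ _) (sym eq) -p≤r

p≤∣p∣ : ∀ p → p ℚ.≤ ℚ.∣ p ∣
p≤∣p∣ p with ℚ.≤-total 0ℚ p
... | inj₁ 0≤p = ℚ.≤-reflexive (sym (ℚ.0≤p⇒∣p∣≡p 0≤p))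
... | inj₂ p≤0 = ℚ.≤-trans p≤0 (ℚ.0≤∣p∣ p)

∣p-q∣≡∣q-p∣ : ∀ p q → ℚ.∣ p ℚ.- q ∣ ≡ ℚ.∣ q ℚ.- p ∣
∣p-q∣≡∣q-p∣ p q = trans (sym (ℚ.∣-p∣≡∣p∣ (p ℚ.- q)))
  (cong ℚ.∣_∣ (solve 2 (λ a b → :- (a :- b) := b :- a) refl p q))

p≤q+r⇒p-q≤r : ∀ {p q r} → p ℚ.≤ q ℚ.+ r → p ℚ.- q ℚ.≤ r
p≤q+r⇒p-q≤r {p} {q} {r} le = subst (p ℚ.- q ℚ.≤_)
  (solve 2 (λ b c → b :+ c :- b := c) refl q r) (ℚ.+-monoˡ-≤ (ℚ.- q) le)

∣-∣-bound : ∀ {p q r} → p ℚ.≤ q ℚ.+ r → q ℚ.≤ p ℚ.+ r → ℚ.∣ p ℚ.- q ∣ ℚ.≤ r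
∣-∣-bound {p} {q} p≤q+r q≤p+r = ∣-∣-lub (p≤q+r⇒p-q≤r p≤q+r)
  (subst (ℚ._≤ _) (solve 2 (λ a b → b :- a := :- (a :- b)) refl p q)
    (p≤q+r⇒p-q≤r q≤p+r))

p≤q+∣p-q∣ : ∀ p q → p ℚ.≤ q ℚ.+ ℚ.∣ p ℚ.- q ∣
p≤q+∣p-q∣ p q = subst (ℚ._≤ q ℚ.+ ℚ.∣ p ℚ.- q ∣)
  (solve 2 (λ a b → b :+ (a :- b) := a) refl p q)
  (ℚ.+-monoʳ-≤ q (p≤∣p∣ (p ℚ.- q)))

∣-∣-triangle : ∀ p q r → ℚ.∣ p ℚ.- r ∣ ℚ.≤ ℚ.∣ p ℚ.- q ∣ ℚ.+ ℚ.∣ q ℚ.- r ∣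
∣-∣-triangle p q r = subst (λ s → ℚ.∣ s ∣ ℚ.≤ ℚ.∣ p ℚ.- q ∣ ℚ.+ ℚ.∣ q ℚ.- r ∣)
  (solve 3 (λ a b c → (a :- b) :+ (b :- c) := a :- c) refl p q r)
  (ℚ.∣p+q∣≤∣p∣+∣q∣ (p ℚ.- q) (q ℚ.- r))

half+half : ∀ p → ½ ℚ.* p ℚ.+ ½ ℚ.* p ≡ p
half+half p = trans (sym (ℚ.*-distribʳ-+ p ½ ½)) (ℚ.*-identityˡ p)

0<half : ∀ {p} → 0ℚ ℚ.< p → 0ℚ ℚ.< ½ ℚ.* p
0<half {p} 0<p = subst (ℚ._< ½ ℚ.* p) (ℚ.*-zeroʳ ½) (ℚ.*-monoʳ-<-pos ½ 0<p)

distℚ : ℚ → ℚ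
distℚ p = ℚ.∣ p ℚ.- fromℤ (ℚ.round p) ∣

toℚᵘ-fromℤ : ∀ i → toℚᵘ (fromℤ i) ℚᵘ.≃ mkℚᵘ i 0
toℚᵘ-fromℤ i = ℚ.toℚᵘ-fromℚᵘ (mkℚᵘ i 0)

fromℤ-neg : ∀ i → fromℤ (ℤ.- i) ≡ ℚ.- fromℤ i
fromℤ-neg i = ℚ.toℚᵘ-injective (ℚᵘ.≃-trans (toℚᵘ-fromℤ (ℤ.- i))
  (ℚᵘ.≃-sym (ℚᵘ.≃-trans (ℚ.toℚᵘ-homo‿- (fromℤ i)) (ℚᵘ.-‿cong (toℚᵘ-fromℤ i)))))

fromℤ-suc : ∀ i → fromℤ (ℤ.suc i) ≡ 1ℚ ℚ.+ fromℤ i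
fromℤ-suc i = ℚ.toℚᵘ-injective (ℚᵘ.≃-trans (toℚᵘ-fromℤ (ℤ.suc i))
  (ℚᵘ.≃-sym (ℚᵘ.≃-trans (ℚ.toℚᵘ-homo-+ 1ℚ (fromℤ i))
    (ℚᵘ.≃-trans (ℚᵘ.+-cong (ℚᵘ.≃-refl {mkℚᵘ (+ 1) 0}) (toℚᵘ-fromℤ i))
      (ℚᵘ.*≡* (cong (λ j → (+ 1 ℤ.+ j) ℤ.* + 1) (ℤ.*-identityʳ i)))))))

fromℤ-mono : ∀ {i j} → i ℤ.≤ j → fromℤ i ℚ.≤ fromℤ j
fromℤ-mono {i} {j} i≤j = ℚ.toℚᵘ-cancel-≤
  (ℚᵘ.≤-respˡ-≃ (ℚᵘ.≃-sym (toℚᵘ-fromℤ i)) (ℚᵘ.≤-respʳ-≃ (ℚᵘ.≃-sym (toℚᵘ-fromℤ j))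
    (ℚᵘ.*≤* (ℤ.*-monoʳ-≤-nonNeg (+ 1) i≤j))))

floor-≤ : ∀ p → fromℤ (ℚ.floor p) ℚ.≤ p
floor-≤ p@(mkℚ n d _) = ℚ.toℚᵘ-cancel-≤
  (ℚᵘ.≤-respˡ-≃ (ℚᵘ.≃-sym (toℚᵘ-fromℤ (ℚ.floor p)))
    (ℚᵘ.*≤* (subst (ℚ.floor p ℤ.* + suc d ℤ.≤_) (sym (ℤ.*-identityʳ n))
      (ℤ.[n/d]*d≤n n (+ suc d)))))

≤-1+floor : ∀ p → p ℚ.≤ 1ℚ ℚ.+ fromℤ (ℚ.floor p)
≤-1+floor p@(mkℚ n d _) = subst (p ℚ.≤_) (fromℤ-suc (ℚ.floor p)) (ℚ.toℚᵘ-cancel-≤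
  (ℚᵘ.≤-respʳ-≃ (ℚᵘ.≃-sym (toℚᵘ-fromℤ (ℤ.suc (ℚ.floor p))))
    (ℚᵘ.*≤* (subst₂ ℤ._≤_ (sym (ℤ.*-identityʳ n))
      (cong (λ i → ℤ.suc i ℤ.* + suc d) (sym (ℤ.div-pos-is-/ℕ n (suc d))))
      (ℤ.<⇒≤ (ℤ.n<s[n/ℕd]*d n (suc d)))))))

ceiling-≡ : ∀ p → ℚ.ceiling p ≡ ℤ.- ℚ.floor (ℚ.- p)
ceiling-≡ (mkℚ _ _ _) = refl

floor-half : ∀ p → ℚ.∣ p ℚ.- fromℤ (ℚ.floor (p ℚ.+ ½)) ∣ ℚ.≤ ½
floor-half p = ∣-∣-bound upper lower
  where
  k = fromℤ (ℚ.floor (p ℚ.+ ½))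

  upper : p ℚ.≤ k ℚ.+ ½
  upper = subst₂ ℚ._≤_
    (solve 1 (λ a → a :+ con ½ :- con ½ := a) refl p)
    (solve 1 (λ a → con 1ℚ :+ a :- con ½ := a :+ con ½) refl k)
    (ℚ.+-monoˡ-≤ (ℚ.- ½) (≤-1+floor (p ℚ.+ ½)))

  lower : k ℚ.≤ p ℚ.+ ½
  lower = floor-≤ (p ℚ.+ ½)

distℚ≤½ : ∀ p → distℚ p ℚ.≤ ½
distℚ≤½ p with p ℚ.≤ᵇ 0ℚ
... | false = floor-half p
... | true  = subst (ℚ._≤ ½) eq (floor-half (ℚ.- p))
  where
  f = ℚ.floor (ℚ.- p ℚ.+ ½)

  eq : ℚ.∣ ℚ.- p ℚ.- fromℤ f ∣ ≡ ℚ.∣ p ℚ.- fromℤ (ℚ.ceiling (p ℚ.- ½)) ∣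
  eq = trans (sym (ℚ.∣-p∣≡∣p∣ (ℚ.- p ℚ.- fromℤ f))) (cong ℚ.∣_∣
    (trans (solve 2 (λ a b → :- (:- a :- b) := a :- :- b) refl p (fromℤ f))
    (cong (λ q → p ℚ.- q) (trans (sym (fromℤ-neg f)) (cong fromℤ
      (trans (cong (λ q → ℤ.- ℚ.floor q)
               (solve 1 (λ a → :- a :+ con ½ := :- (a :- con ½)) refl p))
             (sym (ceiling-≡ (p ℚ.- ½)))))))))

1≤gap : ∀ {i j} → i ℤ.< j → 1ℚ ℚ.+ fromℤ i ℚ.≤ fromℤ j
1≤gap {i} i<j = subst (ℚ._≤ _) (fromℤ-suc i) (fromℤ-mono (ℤ.i<j⇒suc[i]≤j i<j))

far : ∀ p a b → 1ℚ ℚ.+ a ℚ.≤ b → ℚ.∣ p ℚ.- a ∣ ℚ.≤ ½ → ½ ℚ.≤ ℚ.∣ p ℚ.- b ∣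
far p a b gap near = ℚ.≤-trans half≤b-p
  (subst (b ℚ.- p ℚ.≤_) (∣p-q∣≡∣q-p∣ b p) (p≤∣p∣ (b ℚ.- p)))
  where
  half≤b-p : ½ ℚ.≤ b ℚ.- p
  half≤b-p = subst₂ ℚ._≤_
    (solve 1 (λ y → (con 1ℚ :+ y) :+ (:- (y :+ con ½)) := con ½) refl a)
    refl
    (ℚ.+-mono-≤ gap (ℚ.neg-antimono-≤
      (ℚ.≤-trans (p≤q+∣p-q∣ p a) (ℚ.+-monoʳ-≤ a near))))

far′ : ∀ p a b → 1ℚ ℚ.+ b ℚ.≤ a → ℚ.∣ p ℚ.- a ∣ ℚ.≤ ½ → ½ ℚ.≤ ℚ.∣ p ℚ.- b ∣
far′ p a b gap near = ℚ.≤-trans half≤p-b (p≤∣p∣ (p ℚ.- b))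
  where
  a≤p+½ : a ℚ.≤ p ℚ.+ ½
  a≤p+½ = ℚ.≤-trans (p≤q+∣p-q∣ a p)
    (ℚ.+-monoʳ-≤ p (subst (ℚ._≤ ½) (∣p-q∣≡∣q-p∣ p a) near))

  half≤p-b : ½ ℚ.≤ p ℚ.- b
  half≤p-b = subst₂ ℚ._≤_
    (solve 1 (λ y → (con 1ℚ :+ y) :+ (:- (con ½) :- y) := con ½) refl b)
    (solve 2 (λ x y → (x :+ con ½) :+ (:- (con ½) :- y) := x :- y) refl p b)
    (ℚ.+-monoˡ-≤ (ℚ.- ½ ℚ.- b) (ℚ.≤-trans gap a≤p+½))

distℚ-nearest : ∀ p (k : ℤ) → distℚ p ℚ.≤ ℚ.∣ p ℚ.- fromℤ k ∣
distℚ-nearest p k with ℤ.<-cmp (ℚ.round p) k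
... | tri< r<k _ _ = ℚ.≤-trans (distℚ≤½ p)
  (far p (fromℤ (ℚ.round p)) (fromℤ k) (1≤gap r<k) (distℚ≤½ p))
... | tri≈ _ r≡k _ = ℚ.≤-reflexive (cong (λ i → ℚ.∣ p ℚ.- fromℤ i ∣) r≡k)
... | tri> _ _ k<r = ℚ.≤-trans (distℚ≤½ p)
  (far′ p (fromℤ (ℚ.round p)) (fromℤ k) (1≤gap k<r) (distℚ≤½ p))

distℚ-step : ∀ p q → distℚ p ℚ.≤ distℚ q ℚ.+ ℚ.∣ p ℚ.- q ∣
distℚ-step p q = ℚ.≤-trans (distℚ-nearest p (ℚ.round q))
  (subst (ℚ.∣ p ℚ.- fromℤ (ℚ.round q) ∣ ℚ.≤_) (ℚ.+-comm ℚ.∣ p ℚ.- q ∣ (distℚ q))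
    (∣-∣-triangle p q (fromℤ (ℚ.round q))))

distℚ-nonexpansive : ∀ p q → ℚ.∣ distℚ p ℚ.- distℚ q ∣ ℚ.≤ ℚ.∣ p ℚ.- q ∣
distℚ-nonexpansive p q = ∣-∣-bound (distℚ-step p q)
  (subst (λ s → distℚ q ℚ.≤ distℚ p ℚ.+ s) (∣p-q∣≡∣q-p∣ q p) (distℚ-step q p))

Eventually : Pred ℕ 0ℓ → Set
Eventually P = ∃[ N ] (∀ n → N ℕ.≤ n → P n)

-- Real numbers are Cauchy sequences with a modulus, taken up to _≃_.
record ℝ : Set where
  constructor mkℝ
  field
    seq    : ℕ → ℚ
    cauchy : ∀ ε → 0ℚ ℚ.< ε →
             ∃[ N ] (∀ m n → N ℕ.≤ m → N ℕ.≤ n → ℚ.∣ seq m ℚ.- seq n ∣ ℚ.< ε)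

open ℝ public

infix 4 _≃_ _≤_ _<_

_≃_ : Rel ℝ 0ℓ
x ≃ y = ∀ ε → 0ℚ ℚ.< ε → Eventually (λ n → ℚ.∣ seq x n ℚ.- seq y n ∣ ℚ.< ε)

_≤_ : Rel ℝ 0ℓ
x ≤ y = ∀ ε → 0ℚ ℚ.< ε → Eventually (λ n → seq x n ℚ.< seq y n ℚ.+ ε)

_<_ : Rel ℝ 0ℓ
x < y = ∃[ ε ] (0ℚ ℚ.< ε × Eventually (λ n → seq x n ℚ.+ ε ℚ.< seq y n))

fromℚ : ℚ → ℝ
fromℚ p = mkℝ (λ _ → p) λ ε 0<ε → 0 , λ _ _ _ _ →
  subst (ℚ._< ε) (cong ℚ.∣_∣ (sym (ℚ.+-inverseʳ p))) 0<ε

Nonexpansive₁ : (ℚ → ℚ) → Set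
Nonexpansive₁ f = ∀ p q → ℚ.∣ f p ℚ.- f q ∣ ℚ.≤ ℚ.∣ p ℚ.- q ∣

Nonexpansive₂ : (ℚ → ℚ → ℚ) → Set
Nonexpansive₂ f = ∀ p p′ q q′ →
  ℚ.∣ f p q ℚ.- f p′ q′ ∣ ℚ.≤ ℚ.∣ p ℚ.- p′ ∣ ℚ.+ ℚ.∣ q ℚ.- q′ ∣

lift₁ : (f : ℚ → ℚ) → Nonexpansive₁ f → ℝ → ℝ
lift₁ f nonexp x = mkℝ (λ n → f (seq x n)) λ ε 0<ε →
  let N , bound = cauchy x ε 0<ε in
  N , λ m n N≤m N≤n → ℚ.≤-<-trans (nonexp (seq x m) (seq x n)) (bound m n N≤m N≤n)

lift₂ : (f : ℚ → ℚ → ℚ) → Nonexpansive₂ f → ℝ → ℝ → ℝ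
lift₂ f nonexp x y = mkℝ (λ n → f (seq x n) (seq y n)) λ ε 0<ε →
  let M , boundx = cauchy x (½ ℚ.* ε) (0<half 0<ε)
      N , boundy = cauchy y (½ ℚ.* ε) (0<half 0<ε)
  in
  M ℕ.⊔ N , λ m n le le′ →
    ℚ.≤-<-trans (nonexp (seq x m) (seq x n) (seq y m) (seq y n))
      (subst (ℚ.∣ seq x m ℚ.- seq x n ∣ ℚ.+ ℚ.∣ seq y m ℚ.- seq y n ∣ ℚ.<_) (half+half ε)
        (ℚ.+-mono-<
          (boundx m n (ℕ.m⊔n≤o⇒m≤o M N le) (ℕ.m⊔n≤o⇒m≤o M N le′))
          (boundy m n (ℕ.m⊔n≤o⇒n≤o M N le) (ℕ.m⊔n≤o⇒n≤o M N le′))))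

∣-∣-nonexpansive : Nonexpansive₁ ℚ.∣_∣
∣-∣-nonexpansive p q = ∣-∣-bound (step p q)
  (subst (λ s → ℚ.∣ q ∣ ℚ.≤ ℚ.∣ p ∣ ℚ.+ s) (∣p-q∣≡∣q-p∣ q p) (step q p))
  where
  step : ∀ a b → ℚ.∣ a ∣ ℚ.≤ ℚ.∣ b ∣ ℚ.+ ℚ.∣ a ℚ.- b ∣
  step a b = subst (λ s → ℚ.∣ s ∣ ℚ.≤ ℚ.∣ b ∣ ℚ.+ ℚ.∣ a ℚ.- b ∣)
    (solve 2 (λ x y → y :+ (x :- y) := x) refl a b)
    (ℚ.∣p+q∣≤∣p∣+∣q∣ b (a ℚ.- b))

minus-nonexpansive : Nonexpansive₂ ℚ._-_
minus-nonexpansive p p′ q q′ = subst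
  (λ s → ℚ.∣ s ∣ ℚ.≤ ℚ.∣ p ℚ.- p′ ∣ ℚ.+ ℚ.∣ q ℚ.- q′ ∣)
  (solve 4 (λ a a′ b b′ → (a :- a′) :- (b :- b′) := (a :- b) :- (a′ :- b′)) refl p p′ q q′)
  (ℚ.∣p-q∣≤∣p∣+∣q∣ (p ℚ.- p′) (q ℚ.- q′))

min-step : ∀ p p′ q q′ →
  p ℚ.⊓ q ℚ.≤ p′ ℚ.⊓ q′ ℚ.+ (ℚ.∣ p ℚ.- p′ ∣ ℚ.+ ℚ.∣ q ℚ.- q′ ∣)
min-step p p′ q q′ with ℚ.⊓-sel p′ q′
... | inj₁ eq rewrite eq = ℚ.≤-trans (ℚ.p⊓q≤p p q) (ℚ.≤-trans (p≤q+∣p-q∣ p p′)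
  (ℚ.+-monoʳ-≤ p′ (subst (ℚ._≤ ℚ.∣ p ℚ.- p′ ∣ ℚ.+ ℚ.∣ q ℚ.- q′ ∣) (ℚ.+-identityʳ _)
    (ℚ.+-monoʳ-≤ ℚ.∣ p ℚ.- p′ ∣ (ℚ.0≤∣p∣ (q ℚ.- q′))))))
... | inj₂ eq rewrite eq = ℚ.≤-trans (ℚ.p⊓q≤q p q) (ℚ.≤-trans (p≤q+∣p-q∣ q q′)
  (ℚ.+-monoʳ-≤ q′ (subst (ℚ._≤ ℚ.∣ p ℚ.- p′ ∣ ℚ.+ ℚ.∣ q ℚ.- q′ ∣) (ℚ.+-identityˡ _)
    (ℚ.+-monoˡ-≤ ℚ.∣ q ℚ.- q′ ∣ (ℚ.0≤∣p∣ (p ℚ.- p′))))))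

min-nonexpansive : Nonexpansive₂ ℚ._⊓_
min-nonexpansive p p′ q q′ = ∣-∣-bound (min-step p p′ q q′)
  (subst (λ s → p′ ℚ.⊓ q′ ℚ.≤ p ℚ.⊓ q ℚ.+ s)
    (cong₂ ℚ._+_ (∣p-q∣≡∣q-p∣ p′ p) (∣p-q∣≡∣q-p∣ q′ q)) (min-step p′ p q′ q))

infixl 7 _⊓_ _·_
infixl 6 _-_ _+_

_+_ : ℝ → ℝ → ℝ
_+_ = lift₂ ℚ._+_ λ p p′ q q′ → subst
  (λ s → ℚ.∣ s ∣ ℚ.≤ ℚ.∣ p ℚ.- p′ ∣ ℚ.+ ℚ.∣ q ℚ.- q′ ∣)
  (solve 4 (λ a a′ b b′ → (a :- a′) :+ (b :- b′) := (a :+ b) :- (a′ :+ b′)) refl p p′ q q′)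
  (ℚ.∣p+q∣≤∣p∣+∣q∣ (p ℚ.- p′) (q ℚ.- q′))

_-_ : ℝ → ℝ → ℝ
_-_ = lift₂ ℚ._-_ minus-nonexpansive

∣_∣ : ℝ → ℝ
∣_∣ = lift₁ ℚ.∣_∣ ∣-∣-nonexpansive

_⊓_ : ℝ → ℝ → ℝ
_⊓_ = lift₂ ℚ._⊓_ min-nonexpansive

_·_ : ℝ → ℕ → ℝ
x · v = mkℝ (λ n → seq x n ℚ.* fromℕ v) cauchy′
  where
  -- ε is divided by 1 + v so that v = 0 needs no separate case.
  cauchy′ : ∀ ε → 0ℚ ℚ.< ε → ∃[ N ] (∀ m n → N ℕ.≤ m → N ℕ.≤ n →
            ℚ.∣ seq x m ℚ.* fromℕ v ℚ.- seq x n ℚ.* fromℕ v ∣ ℚ.< ε)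
  cauchy′ ε 0<ε = N , λ m n N≤m N≤n → subst (ℚ._< ε) (eq m n)
    (ℚ.≤-<-trans
      (ℚ.*-monoˡ-≤-nonNeg ℚ.∣ seq x m ℚ.- seq x n ∣
        {{ℚ.∣-∣-nonNeg (seq x m ℚ.- seq x n)}} v≤1+v)
      (subst (ℚ.∣ seq x m ℚ.- seq x n ∣ ℚ.* c ℚ.<_) ε/c*c≡ε
        (ℚ.*-monoˡ-<-pos c (bound m n N≤m N≤n))))
    where
    c : ℚ
    c = fromℕ (suc v)

    instance
      c-pos : ℚ.Positive c
      c-pos = ℚ.normalize-pos (suc v) 1

      c-nonZero : ℚ.NonZero c
      c-nonZero = ℚ.pos⇒nonZero c

      1/c-pos : ℚ.Positive (ℚ.1/ c)
      1/c-pos = ℚ.1/pos⇒pos c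

    0<ε/c : 0ℚ ℚ.< ε ℚ.* ℚ.1/ c
    0<ε/c = subst (ℚ._< ε ℚ.* ℚ.1/ c) (ℚ.*-zeroˡ (ℚ.1/ c)) (ℚ.*-monoˡ-<-pos (ℚ.1/ c) 0<ε)

    N = proj₁ (cauchy x (ε ℚ.* ℚ.1/ c) 0<ε/c)
    bound = proj₂ (cauchy x (ε ℚ.* ℚ.1/ c) 0<ε/c)

    ε/c*c≡ε : ε ℚ.* ℚ.1/ c ℚ.* c ≡ ε
    ε/c*c≡ε = trans (ℚ.*-assoc ε (ℚ.1/ c) c)
      (trans (cong (ε ℚ.*_) (ℚ.*-inverseˡ c)) (ℚ.*-identityʳ ε))

    v≤1+v : fromℕ v ℚ.≤ c
    v≤1+v = fromℤ-mono (ℤ.+≤+ (ℕ.n≤1+n v))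

    eq : ∀ m n → ℚ.∣ seq x m ℚ.- seq x n ∣ ℚ.* fromℕ v
               ≡ ℚ.∣ seq x m ℚ.* fromℕ v ℚ.- seq x n ℚ.* fromℕ v ∣
    eq m n = trans
      (cong (ℚ.∣ seq x m ℚ.- seq x n ∣ ℚ.*_)
        (sym (ℚ.0≤p⇒∣p∣≡p (fromℤ-mono (ℤ.+≤+ (ℕ.z≤n {v}))))))
      (trans (sym (ℚ.∣p*q∣≡∣p∣*∣q∣ (seq x m ℚ.- seq x n) (fromℕ v)))
        (cong ℚ.∣_∣ (solve 3 (λ a b w → (a :- b) :* w := a :* w :- b :* w) refl
          (seq x m) (seq x n) (fromℕ v))))

-- "The nearest integer" is not computable from a real, but the distance to it
-- is, as the continuous extension of distℚ.  ‖-‖-≤ and ‖-‖-approx together say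
-- that ‖ x ‖ is the infimum of ∣ x - k ∣ over the integers k.

‖_‖ : ℝ → ℝ
‖_‖ = lift₁ distℚ distℚ-nonexpansive

‖-‖-≤ : ∀ x (k : ℤ) → ‖ x ‖ ≤ ∣ x - fromℚ (fromℤ k) ∣
‖-‖-≤ x k ε 0<ε = 0 , λ n _ → ℚ.≤-<-trans (distℚ-nearest (seq x n) k)
  (subst (ℚ._< ℚ.∣ seq x n ℚ.- fromℤ k ∣ ℚ.+ ε) (ℚ.+-identityʳ _)
    (ℚ.+-monoʳ-< ℚ.∣ seq x n ℚ.- fromℤ k ∣ 0<ε))

‖-‖-approx : ∀ x ε → 0ℚ ℚ.< ε → ∃[ k ] ∣ x - fromℚ (fromℤ k) ∣ ≤ ‖ x ‖ + fromℚ ε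
‖-‖-approx x ε 0<ε = k , λ δ 0<δ → N , λ n N≤n →
  let a = seq x n
      s = ℚ.∣ a ℚ.- b ∣
      s<ε/2 = bound n N N≤n ℕ.≤-refl
      db≤ = subst (λ r → distℚ b ℚ.≤ distℚ a ℚ.+ r) (∣p-q∣≡∣q-p∣ b a) (distℚ-step b a)
      total : s ℚ.+ (distℚ a ℚ.+ s) ℚ.≤ distℚ a ℚ.+ ε
      total = subst₂ ℚ._≤_
        (solve 2 (λ d t → d :+ (t :+ t) := t :+ (d :+ t)) refl (distℚ a) s)
        (cong (distℚ a ℚ.+_) (half+half ε))
        (ℚ.+-monoʳ-≤ (distℚ a) (ℚ.<⇒≤ (ℚ.+-mono-< s<ε/2 s<ε/2)))
  in ℚ.≤-<-trans
       (ℚ.≤-trans (∣-∣-triangle a b (fromℤ k)) (ℚ.≤-trans (ℚ.+-monoʳ-≤ s db≤) total))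
       (subst (ℚ._< distℚ a ℚ.+ ε ℚ.+ δ) (ℚ.+-identityʳ _) (ℚ.+-monoʳ-< (distℚ a ℚ.+ ε) 0<δ))
  where
  N = proj₁ (cauchy x (½ ℚ.* ε) (0<half 0<ε))
  bound = proj₂ (cauchy x (½ ℚ.* ε) (0<half 0<ε))
  b = seq x N
  k = ℚ.round b

minimum : ∀ {n} → (Fin (suc n) → ℝ) → ℝ
minimum {zero}  f = f zero
minimum {suc n} f = f zero ⊓ minimum (λ i → f (suc i))

IsMaximum : {I : Set} → (I → ℝ) → ℝ → Set
IsMaximum f M = (∃[ i ] f i ≃ M) × (∀ i → f i ≤ M)

_⟶_ : (ℕ → ℝ) → ℝ → Set
a ⟶ A = ∀ ε → 0ℚ ℚ.< ε → Eventually (λ k → ∣ a k - A ∣ < fromℚ ε)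

-- A is ML(v₁,…,vₙ) for n = 1 + m ≥ 1.
IsML : ∀ {m} → (Fin (suc m) → ℕ) → ℝ → Set
IsML v = IsMaximum (λ (t : ℝ) → minimum (λ i → ‖ t · v i ‖))

-- ML of an empty tuple is undefined, so the spectrum for n = 0 is empty.
𝒮 : ℕ → Pred ℝ 0ℓ
𝒮 zero    A = ⊥
𝒮 (suc m) A = Σ[ v ∈ (Fin (suc m) → ℕ) ] ((∀ i → 0 ℕ.< v i) × IsML v A)

LowerAccumulationPoint : ℕ → Pred ℝ 0ℓ
LowerAccumulationPoint n A =
  Σ[ a ∈ (ℕ → ℝ) ] ((∀ k → 𝒮 n (a k)) × (∀ k → a k < A) × (a ⟶ A))

{-# OPTIONS --safe #-}
module Submission where

-- Let f(t) = min ‖t vᵢ‖ and let Q be a common multiple of all vᵢ + vⱼ, i = j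
-- included.  Strictly between two neighbouring points of the grid (1/Q)ℤ, f is
-- smaller than at one of them; so f attains its maximum M over ℚ, only on the
-- grid, and M > 0.  Add a runner of speed V = (k + 1) Q.  It is at 0 at every
-- grid time, so the new maximum is strictly below M.  At time t₀ + 1/(2V), where
-- f(t₀) = M, it is at distance 1/2 while the other runners have moved by
-- O(1/k), so the new maxima tend to M.

open import Defs
open import Data.Nat.Base using (ℕ; _∸_) renaming (_≤_ to _≤ℕ_)
open import Relation.Unary using (_⊆_)

open import Data.Fin.Base using (Fin; zero; suc)
open import Data.Integer.Base as ℤ using (ℤ; +_)
import Data.Integer.DivMod as ℤ
import Data.Integer.Properties as ℤ
open import Data.Nat.Base as ℕ using (zero; suc; z≤n; s≤s)
open import Data.Nat.Divisibility using (_∣_; quotient; ∣⇒≤; ∣-trans; m∣m*n; m≤n⇒m!∣n!)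
import Data.Nat.Properties as ℕ
open import Data.Product.Base using (∃-syntax; _×_; _,_; proj₁; proj₂)
open import Data.Rational.Base as ℚ using (ℚ; 0ℚ; 1ℚ; ½; _/_)
import Data.Rational.Properties as ℚ
open import Data.Rational.Solver using (module +-*-Solver)
open import Data.Rational.Unnormalised.Base as ℚᵘ using (mkℚᵘ)
import Data.Rational.Unnormalised.Properties as ℚᵘ
open import Data.Sum.Base using (_⊎_; inj₁; inj₂; [_,_]′)
open import Data.Vec.Functional using (_∷_)
open import Function.Base using (_∘_)
open import Relation.Binary.Definitions using (Tri; tri<; tri≈; tri>)
open import Relation.Binary.PropositionalEquality using (_≡_; refl; sym; trans; cong; cong₂; subst; subst₂)
open import Relation.Nullary.Decidable.Core using (yes; no)
open import Relation.Nullary.Negation.Core using (¬_; contradiction)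

open +-*-Solver using (solve; _:=_; _:+_; _:*_; _:-_; :-_; con)

-- Arithmetic of the embeddings of ℤ and ℕ into ℚ.

<⇒≱ : ∀ {p q} → p ℚ.< q → ¬ q ℚ.≤ p
<⇒≱ p<q q≤p = ℚ.<-irrefl refl (ℚ.<-≤-trans p<q q≤p)

fromℤ-+ : ∀ i j → fromℤ (i ℤ.+ j) ≡ fromℤ i ℚ.+ fromℤ j
fromℤ-+ i j = ℚ.toℚᵘ-injective (ℚᵘ.≃-trans (toℚᵘ-fromℤ (i ℤ.+ j))
  (ℚᵘ.≃-sym (ℚᵘ.≃-trans (ℚ.toℚᵘ-homo-+ (fromℤ i) (fromℤ j))
    (ℚᵘ.≃-trans (ℚᵘ.+-cong (toℚᵘ-fromℤ i) (toℚᵘ-fromℤ j))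
      (ℚᵘ.*≡* (cong (ℤ._* + 1) (cong₂ ℤ._+_ (ℤ.*-identityʳ i) (ℤ.*-identityʳ j))))))))

fromℤ-* : ∀ i j → fromℤ (i ℤ.* j) ≡ fromℤ i ℚ.* fromℤ j
fromℤ-* i j = ℚ.toℚᵘ-injective (ℚᵘ.≃-trans (toℚᵘ-fromℤ (i ℤ.* j))
  (ℚᵘ.≃-sym (ℚᵘ.≃-trans (ℚ.toℚᵘ-homo-* (fromℤ i) (fromℤ j))
    (ℚᵘ.≃-trans (ℚᵘ.*-cong (toℚᵘ-fromℤ i) (toℚᵘ-fromℤ j)) (ℚᵘ.*≡* refl)))))

fromℕ-+ : ∀ m n → fromℕ (m ℕ.+ n) ≡ fromℕ m ℚ.+ fromℕ n
fromℕ-+ m n = fromℤ-+ (+ m) (+ n)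

fromℕ-* : ∀ m n → fromℕ (m ℕ.* n) ≡ fromℕ m ℚ.* fromℕ n
fromℕ-* m n = trans (cong fromℤ (ℤ.pos-* m n)) (fromℤ-* (+ m) (+ n))

fromℕ-mono : ∀ {m n} → m ℕ.≤ n → fromℕ m ℚ.≤ fromℕ n
fromℕ-mono m≤n = fromℤ-mono (ℤ.+≤+ m≤n)

fromℤ-cancel-< : ∀ {i j} → fromℤ i ℚ.< fromℤ j → i ℤ.< j
fromℤ-cancel-< i<j = ℤ.≰⇒> λ j≤i → <⇒≱ i<j (fromℤ-mono j≤i)

fromℕ-pos : ∀ n .{{_ : ℕ.NonZero n}} → ℚ.Positive (fromℕ n)
fromℕ-pos n = ℚ.normalize-pos n 1

/-cancelʳ : ∀ i n .{{_ : ℕ.NonZero n}} → (i / n) ℚ.* fromℕ n ≡ fromℤ i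
/-cancelʳ i n@(suc d) = ℚ.toℚᵘ-injective
  (ℚᵘ.≃-trans (ℚ.toℚᵘ-homo-* (i / n) (fromℕ n))
  (ℚᵘ.≃-trans (ℚᵘ.*-cong (ℚ.toℚᵘ-fromℚᵘ (mkℚᵘ i d)) (toℚᵘ-fromℤ (+ n)))
  (ℚᵘ.≃-trans (ℚᵘ.*≡* (trans (ℤ.*-identityʳ (i ℤ.* + n)) (cong (λ m → i ℤ.* + m) (sym (ℕ.*-identityʳ n)))))
    (ℚᵘ.≃-sym (toℚᵘ-fromℤ i)))))

-- With `k` the floor of `1/ε`, one has `1/ε ≤ 1 + k ≤ 1 + |k|`. The product form keeps division out
-- of the convergence estimates.
archimedean : ∀ ε → 0ℚ ℚ.< ε → ∃[ N ] 1ℚ ℚ.≤ ε ℚ.* fromℕ (suc N)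
archimedean ε 0<ε = ℤ.∣ k ∣ , subst (ℚ._≤ ε ℚ.* fromℕ (suc ℤ.∣ k ∣)) (ℚ.*-inverseʳ ε)
  (ℚ.*-monoˡ-≤-nonNeg ε (ℚ.≤-trans (≤-1+floor (ℚ.1/ ε))
    (subst (ℚ._≤ fromℕ (suc ℤ.∣ k ∣)) (fromℤ-suc k)
      (fromℤ-mono (ℤ.+-monoʳ-≤ (+ 1) (i≤∣i∣ k))))))
  where
  instance
    ε-pos : ℚ.Positive ε
    ε-pos = ℚ.positive 0<ε

    ε-nonNeg : ℚ.NonNegative ε
    ε-nonNeg = ℚ.pos⇒nonNeg ε

    ε-nonZero : ℚ.NonZero ε
    ε-nonZero = ℚ.pos⇒nonZero ε

  k = ℚ.floor (ℚ.1/ ε)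

  i≤∣i∣ : ∀ i → i ℤ.≤ + ℤ.∣ i ∣
  i≤∣i∣ (+ n) = ℤ.≤-refl
  i≤∣i∣ ℤ.-[1+ n ] = ℤ.-≤+

-- Distance to the nearest integer: integers, translates and half-integers.

distℚ-fromℤ : ∀ k → distℚ (fromℤ k) ℚ.≤ 0ℚ
distℚ-fromℤ k = subst (distℚ (fromℤ k) ℚ.≤_) (cong ℚ.∣_∣ (ℚ.+-inverseʳ (fromℤ k)))
  (distℚ-nearest (fromℤ k) k)

-- The integer `round p + k` is as far from `p + k` as `round p` is from `p`, and the nearest
-- integer can only be closer.
distℚ-periodic : ∀ p k → distℚ (p ℚ.+ fromℤ k) ℚ.≤ distℚ p
distℚ-periodic p k = subst (distℚ (p ℚ.+ fromℤ k) ℚ.≤_) eq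
  (distℚ-nearest (p ℚ.+ fromℤ k) (ℚ.round p ℤ.+ k))
  where
  eq : ℚ.∣ p ℚ.+ fromℤ k ℚ.- fromℤ (ℚ.round p ℤ.+ k) ∣ ≡ distℚ p
  eq = cong ℚ.∣_∣ (trans (cong (λ x → p ℚ.+ fromℤ k ℚ.- x) (fromℤ-+ (ℚ.round p) k))
    (solve 3 (λ a b c → a :+ c :- (b :+ c) := a :- b) refl p (fromℤ (ℚ.round p)) (fromℤ k)))

-- How `round` breaks the tie is left open: an integer above `k` is at least 1 from `k`, hence at
-- least ½ from `k + ½`; one not above `k` lies at least ½ below.
distℚ-half-integer : ∀ k → ½ ℚ.≤ distℚ (fromℤ k ℚ.+ ½)
distℚ-half-integer k with ℚ.round (fromℤ k ℚ.+ ½)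
... | r with k ℤ.<? r
...   | yes k<r = far (fromℤ k ℚ.+ ½) (fromℤ k) (fromℤ r) (1≤gap k<r)
        (ℚ.≤-reflexive (cong ℚ.∣_∣ (solve 1 (λ a → a :+ con ½ :- a := con ½) refl (fromℤ k))))
...   | no k≮r = ℚ.≤-trans
        (subst₂ ℚ._≤_ (solve 1 (λ a → a :+ con ½ :- a := con ½) refl (fromℤ r)) refl
          (ℚ.+-monoˡ-≤ (ℚ.- fromℤ r) (ℚ.+-monoˡ-≤ ½ (fromℤ-mono (ℤ.≮⇒≥ k≮r)))))
        (p≤∣p∣ (fromℤ k ℚ.+ ½ ℚ.- fromℤ r))

-- Runners leaving and approaching an integer.

∣p-q∣≤r⇒p≤q+r : ∀ p q {r} → ℚ.∣ p ℚ.- q ∣ ℚ.≤ r → p ℚ.≤ q ℚ.+ r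
∣p-q∣≤r⇒p≤q+r p q le = ℚ.≤-trans (p≤q+∣p-q∣ p q) (ℚ.+-monoʳ-≤ q le)

∣p-q∣≤r⇒q≤p+r : ∀ p q {r} → ℚ.∣ p ℚ.- q ∣ ℚ.≤ r → q ℚ.≤ p ℚ.+ r
∣p-q∣≤r⇒q≤p+r p q le = ∣p-q∣≤r⇒p≤q+r q p (subst (ℚ._≤ _) (∣p-q∣≡∣q-p∣ p q) le)

-- Otherwise `y ≤ a - r`, and then `x < y` would put `x` further than `r` from `a`.
escape-right : ∀ {x y a r} → x ℚ.< y → ℚ.∣ x ℚ.- a ∣ ℚ.≤ r → r ℚ.≤ ℚ.∣ y ℚ.- a ∣ → a ℚ.+ r ℚ.≤ y
escape-right {x} {y} {a} {r} x<y near away with ℚ.∣p∣≡p∨∣p∣≡-p (y ℚ.- a)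
... | inj₁ eq = subst (a ℚ.+ r ℚ.≤_) (solve 2 (λ u v → u :+ (v :- u) := v) refl a y)
  (ℚ.+-monoʳ-≤ a (subst (r ℚ.≤_) eq away))
... | inj₂ eq = contradiction
  (subst (y ℚ.+ r ℚ.≤_) (solve 2 (λ u v → v :+ :- (v :- u) := u) refl a y)
    (ℚ.+-monoʳ-≤ y (subst (r ℚ.≤_) eq away)))
  (<⇒≱ (ℚ.≤-<-trans (∣p-q∣≤r⇒q≤p+r x a near) (ℚ.+-monoˡ-< r x<y)))

escape-left : ∀ {x y a r} → y ℚ.< x → ℚ.∣ x ℚ.- a ∣ ℚ.≤ r → r ℚ.≤ ℚ.∣ y ℚ.- a ∣ → y ℚ.+ r ℚ.≤ a
escape-left {x} {y} {a} {r} y<x near away with ℚ.∣p∣≡p∨∣p∣≡-p (y ℚ.- a)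
... | inj₁ eq = contradiction
  (subst (a ℚ.+ r ℚ.≤_) (solve 2 (λ u v → u :+ (v :- u) := v) refl a y)
    (ℚ.+-monoʳ-≤ a (subst (r ℚ.≤_) eq away)))
  (<⇒≱ (ℚ.<-≤-trans y<x (∣p-q∣≤r⇒p≤q+r x a near)))
... | inj₂ eq = subst (y ℚ.+ r ℚ.≤_) (solve 2 (λ u v → v :+ :- (v :- u) := u) refl a y)
    (ℚ.+-monoʳ-≤ y (subst (r ℚ.≤_) eq away))

-- If neither p nor q beat t, then some runner v leaves an integer a between
-- times p and t while some runner w approaches an integer b between t and q,
-- which traps the integer a + b strictly between p (v + w) and q (v + w).
crossing : ∀ {p t q r} v w .{{_ : ℕ.NonZero v}} .{{_ : ℕ.NonZero w}} {a b : ℤ} →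
  p ℚ.< t → t ℚ.< q →
  ℚ.∣ p ℚ.* fromℕ v ℚ.- fromℤ a ∣ ℚ.≤ r → r ℚ.≤ ℚ.∣ t ℚ.* fromℕ v ℚ.- fromℤ a ∣ →
  ℚ.∣ q ℚ.* fromℕ w ℚ.- fromℤ b ∣ ℚ.≤ r → r ℚ.≤ ℚ.∣ t ℚ.* fromℕ w ℚ.- fromℤ b ∣ →
  p ℚ.* fromℕ (v ℕ.+ w) ℚ.< fromℤ (a ℤ.+ b) ×
  fromℤ (a ℤ.+ b) ℚ.< q ℚ.* fromℕ (v ℕ.+ w)
crossing {p} {t} {q} {r} v w {a} {b} p<t t<q pv≤r r≤tv qw≤r r≤tw =
  -- Adding `p v ≤ a + r` and `p w < t w ≤ b - r` cancels `r`; the other half adds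
  -- `a + r ≤ t v < q v` and `b - r ≤ q w`.
  subst₂ ℚ._<_ (expand p)
    (trans (solve 3 (λ x y z → (x :+ z) :+ (y :- z) := x :+ y) refl (fromℤ a) (fromℤ b) r)
      (sym (fromℤ-+ a b)))
    (ℚ.+-mono-≤-< (∣p-q∣≤r⇒p≤q+r (p ℚ.* fromℕ v) (fromℤ a) pv≤r) (ℚ.<-≤-trans (step w p<t) tw≤b-r)) ,
  subst₂ ℚ._<_
    (trans (solve 3 (λ x y z → (x :+ z) :+ (y :- z) := x :+ y) refl (fromℤ a) (fromℤ b) r)
      (sym (fromℤ-+ a b)))
    (expand q)
    (ℚ.+-mono-<-≤ (ℚ.≤-<-trans a+r≤tv (step v t<q)) b-r≤qw)
  where
  step : ∀ {x y} n .{{_ : ℕ.NonZero n}} → x ℚ.< y → x ℚ.* fromℕ n ℚ.< y ℚ.* fromℕ n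
  step n = ℚ.*-monoˡ-<-pos (fromℕ n) {{fromℕ-pos n}}

  expand : ∀ x → x ℚ.* fromℕ v ℚ.+ x ℚ.* fromℕ w ≡ x ℚ.* fromℕ (v ℕ.+ w)
  expand x = trans (sym (ℚ.*-distribˡ-+ x (fromℕ v) (fromℕ w)))
    (cong (x ℚ.*_) (sym (fromℕ-+ v w)))

  a+r≤tv : fromℤ a ℚ.+ r ℚ.≤ t ℚ.* fromℕ v
  a+r≤tv = escape-right (step v p<t) pv≤r r≤tv

  tw≤b-r : t ℚ.* fromℕ w ℚ.≤ fromℤ b ℚ.- r
  tw≤b-r = subst (ℚ._≤ fromℤ b ℚ.- r) (solve 2 (λ x y → x :+ y :- y := x) refl (t ℚ.* fromℕ w) r)
    (ℚ.+-monoˡ-≤ (ℚ.- r) (escape-left (step w t<q) qw≤r r≤tw))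

  b-r≤qw : fromℤ b ℚ.- r ℚ.≤ q ℚ.* fromℕ w
  b-r≤qw = subst (fromℤ b ℚ.- r ℚ.≤_) (solve 2 (λ x y → x :+ y :- y := x) refl (q ℚ.* fromℕ w) r)
    (ℚ.+-monoˡ-≤ (ℚ.- r) (∣p-q∣≤r⇒q≤p+r (q ℚ.* fromℕ w) (fromℤ b) qw≤r))

-- The objective function at rational times.

-- Follows the recursion of `minimum`, so that the `n`-th approximation of the objective in `IsML`
-- at a real time `t` is `minDist v (seq t n)`.
minDist : ∀ {m} → (Fin (suc m) → ℕ) → ℚ → ℚ
minDist {zero}  v t = distℚ (t ℚ.* fromℕ (v zero))
minDist {suc m} v t = distℚ (t ℚ.* fromℕ (v zero)) ℚ.⊓ minDist (v ∘ suc) t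

minDist-≤ : ∀ {m} (v : Fin (suc m) → ℕ) t i → minDist v t ℚ.≤ distℚ (t ℚ.* fromℕ (v i))
minDist-≤ {zero}  v t zero    = ℚ.≤-refl
minDist-≤ {suc m} v t zero    = ℚ.p⊓q≤p (distℚ (t ℚ.* fromℕ (v zero))) (minDist (v ∘ suc) t)
minDist-≤ {suc m} v t (suc i) = ℚ.≤-trans
  (ℚ.p⊓q≤q (distℚ (t ℚ.* fromℕ (v zero))) (minDist (v ∘ suc) t)) (minDist-≤ (v ∘ suc) t i)

minDist-attained : ∀ {m} (v : Fin (suc m) → ℕ) t → ∃[ i ] distℚ (t ℚ.* fromℕ (v i)) ≡ minDist v t
minDist-attained {zero}  v t = zero , refl
minDist-attained {suc m} v t = [ (λ eq → zero , sym eq) , (λ eq → suc i , trans eq′ (sym eq)) ]′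
  (ℚ.⊓-sel (distℚ (t ℚ.* fromℕ (v zero))) (minDist (v ∘ suc) t))
  where
  i = proj₁ (minDist-attained (v ∘ suc) t)
  eq′ = proj₂ (minDist-attained (v ∘ suc) t)

minDist-glb : ∀ {m} (v : Fin (suc m) → ℕ) t {r} →
  (∀ i → r ℚ.≤ distℚ (t ℚ.* fromℕ (v i))) → r ℚ.≤ minDist v t
minDist-glb v t {r} bound =
  let i , eq = minDist-attained v t in subst (r ℚ.≤_) eq (bound i)

0≤minDist : ∀ {m} (v : Fin (suc m) → ℕ) t → 0ℚ ℚ.≤ minDist v t
0≤minDist v t = minDist-glb v t λ i → ℚ.0≤∣p∣ _

minDist≤½ : ∀ {m} (v : Fin (suc m) → ℕ) t → minDist v t ℚ.≤ ½
minDist≤½ v t = ℚ.≤-trans (minDist-≤ v t zero) (distℚ≤½ (t ℚ.* fromℕ (v zero)))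

-- Speeds are integers, so delaying by the integer `k` moves runner `i` by `k * v i` whole laps.
minDist-periodic : ∀ {m} (v : Fin (suc m) → ℕ) t k → minDist v (t ℚ.+ fromℤ k) ℚ.≤ minDist v t
minDist-periodic v t k = minDist-glb v t λ i → ℚ.≤-trans (minDist-≤ v (t ℚ.+ fromℤ k) i)
  (subst (λ x → distℚ x ℚ.≤ distℚ (t ℚ.* fromℕ (v i)))
    (trans (cong (λ x → t ℚ.* fromℕ (v i) ℚ.+ x) (fromℤ-* k (+ v i)))
      (sym (ℚ.*-distribʳ-+ (fromℕ (v i)) t (fromℤ k))))
    (distℚ-periodic (t ℚ.* fromℕ (v i)) (k ℤ.* + v i)))

argmax : (f : ℕ → ℚ) → ∀ n → ∃[ i ] (∀ j → j ℕ.≤ n → f j ℚ.≤ f i)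
argmax f zero = 0 , λ { zero _ → ℚ.≤-refl }
argmax f (suc n) with argmax f n
... | i , max with ℚ.≤-total (f i) (f (suc n))
...   | inj₁ fi≤ = suc n , λ _ → case
  where
  case : ∀ {j} → j ℕ.≤ suc n → f j ℚ.≤ f (suc n)
  case {j} j≤ with ℕ.m≤n⇒m<n∨m≡n j≤
  ... | inj₁ (s≤s j≤n) = ℚ.≤-trans (max j j≤n) fi≤
  ... | inj₂ refl      = ℚ.≤-refl
...   | inj₂ ≤fi = i , λ _ → case
  where
  case : ∀ {j} → j ℕ.≤ suc n → f j ℚ.≤ f i
  case {j} j≤ with ℕ.m≤n⇒m<n∨m≡n j≤
  ... | inj₁ (s≤s j≤n) = max j j≤n
  ... | inj₂ refl      = ≤fi

-- The grid (1/Q)ℤ and the maximum on it.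

module Grid (Q : ℕ) {{Q≢0 : ℕ.NonZero Q}} where

  private instance
    Q-pos : ℚ.Positive (fromℕ Q)
    Q-pos = fromℕ-pos Q

    Q-nonNeg : ℚ.NonNegative (fromℕ Q)
    Q-nonNeg = ℚ.pos⇒nonNeg (fromℕ Q)

  *Q-injective : ∀ {s t} → s ℚ.* fromℕ Q ≡ t ℚ.* fromℕ Q → s ≡ t
  *Q-injective eq = ℚ.≤-antisym (ℚ.*-cancelʳ-≤-pos (fromℕ Q) (ℚ.≤-reflexive eq))
    (ℚ.*-cancelʳ-≤-pos (fromℕ Q) (ℚ.≤-reflexive (sym eq)))

  /-<-intro : ∀ k t → fromℤ k ℚ.< t ℚ.* fromℕ Q → k / Q ℚ.< t
  /-<-intro k t lt = ℚ.*-cancelʳ-<-nonNeg (fromℕ Q) (subst (ℚ._< t ℚ.* fromℕ Q) (sym (/-cancelʳ k Q)) lt)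

  <-/-intro : ∀ t k → t ℚ.* fromℕ Q ℚ.< fromℤ k → t ℚ.< k / Q
  <-/-intro t k lt = ℚ.*-cancelʳ-<-nonNeg (fromℕ Q) (subst (t ℚ.* fromℕ Q ℚ.<_) (sym (/-cancelʳ k Q)) lt)

  locate : ∀ t → (∃[ k ] t ≡ k / Q) ⊎ (∃[ k ] (k / Q ℚ.< t × t ℚ.< ℤ.suc k / Q))
  locate t = go (ℚ.<-cmp (fromℤ k) x) (ℚ.<-cmp x (fromℤ (ℤ.suc k)))
    where
    x = t ℚ.* fromℕ Q
    k = ℚ.floor x

    go : Tri (fromℤ k ℚ.< x) (fromℤ k ≡ x) (x ℚ.< fromℤ k) →
         Tri (x ℚ.< fromℤ (ℤ.suc k)) (x ≡ fromℤ (ℤ.suc k)) (fromℤ (ℤ.suc k) ℚ.< x) →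
         (∃[ k ] t ≡ k / Q) ⊎ (∃[ k ] (k / Q ℚ.< t × t ℚ.< ℤ.suc k / Q))
    go (tri≈ _ eq _) _ = inj₁ (k , *Q-injective (trans (sym eq) (sym (/-cancelʳ k Q))))
    go (tri> _ _ gt) _ = contradiction (floor-≤ x) (<⇒≱ gt)
    -- The bound `≤-1+floor` is not strict, so the right end of the cell can occur; it is the grid
    -- point of `suc k`.
    go (tri< _ _ _) (tri≈ _ eq _) = inj₁ (ℤ.suc k , *Q-injective (trans eq (sym (/-cancelʳ (ℤ.suc k) Q))))
    go (tri< _ _ _) (tri> _ _ gt) = contradiction (≤-1+floor x) (<⇒≱ (subst (ℚ._< x) (fromℤ-suc k) gt))
    go (tri< lt _ _) (tri< lt′ _ _) = inj₂ (k , /-<-intro k t lt , <-/-intro t (ℤ.suc k) lt′)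

  -- By periodicity this reduces maximisation over the infinite grid to a search through the
  -- residues modulo `Q`.
  /-mod : ∀ k → k / Q ≡ + (k ℤ.%ℕ Q) / Q ℚ.+ fromℤ (k ℤ./ℕ Q)
  /-mod k = *Q-injective (trans (/-cancelʳ k Q)
    (trans (cong fromℤ (ℤ.a≡a%ℕn+[a/ℕn]*n k Q))
    (trans (fromℤ-+ (+ (k ℤ.%ℕ Q)) ((k ℤ./ℕ Q) ℤ.* + Q))
    (trans (cong₂ ℚ._+_ (sym (/-cancelʳ (+ (k ℤ.%ℕ Q)) Q)) (fromℤ-* (k ℤ./ℕ Q) (+ Q)))
      (sym (ℚ.*-distribʳ-+ (fromℕ Q) (+ (k ℤ.%ℕ Q) / Q) (fromℤ (k ℤ./ℕ Q))))))))

  -- Puts a runner whose speed is a multiple of `Q` at an integer at every grid time.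
  multiple-integral : ∀ k n → (k / Q) ℚ.* fromℕ (n ℕ.* Q) ≡ fromℤ (k ℤ.* + n)
  multiple-integral k n = trans (cong ((k / Q) ℚ.*_) (fromℕ-* n Q))
    (trans (solve 3 (λ x y z → x :* (y :* z) := x :* z :* y) refl (k / Q) (fromℕ n) (fromℕ Q))
    (trans (cong (ℚ._* fromℕ n) (/-cancelʳ k Q)) (sym (fromℤ-* k (+ n)))))

  module Maximum {m} (v : Fin (suc m) → ℕ) (v>0 : ∀ i → 0 ℕ.< v i)
                 (v+v∣Q : ∀ i j → v i ℕ.+ v j ∣ Q) where

    -- Apply `crossing` to the runners `i` and `j` attaining the minimum at the two ends of the
    -- cell. Scaling by `n = Q / (v i + v j)` turns the trapped integer `a + b` into an integer
    -- strictly between `k` and `k + 1`.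
    off-grid : ∀ k {t} → k / Q ℚ.< t → t ℚ.< ℤ.suc k / Q →
      ¬ (minDist v (k / Q) ℚ.≤ minDist v t × minDist v (ℤ.suc k / Q) ℚ.≤ minDist v t)
    off-grid k {t} p<t t<q (fp≤ft , fq≤ft) = contradiction c<1+k (ℤ.≤⇒≯ (ℤ.i<j⇒suc[i]≤j k<c))
      where
      i = proj₁ (minDist-attained v (k / Q))
      j = proj₁ (minDist-attained v (ℤ.suc k / Q))
      a = ℚ.round ((k / Q) ℚ.* fromℕ (v i))
      b = ℚ.round ((ℤ.suc k / Q) ℚ.* fromℕ (v j))
      s = v i ℕ.+ v j
      n = quotient (v+v∣Q i j)

      Q≡n*s : Q ≡ n ℕ.* s
      Q≡n*s = _∣_.equality (v+v∣Q i j)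

      instance
        n≢0 : ℕ.NonZero n
        n≢0 = ℕ.m*n≢0⇒m≢0 n {s} {{subst ℕ.NonZero Q≡n*s Q≢0}}

      trapped = crossing (v i) (v j) {{ℕ.>-nonZero (v>0 i)}} {{ℕ.>-nonZero (v>0 j)}} {a} {b} p<t t<q
        (subst (ℚ._≤ minDist v t) (sym (proj₂ (minDist-attained v (k / Q)))) fp≤ft)
        (ℚ.≤-trans (minDist-≤ v t i) (distℚ-nearest (t ℚ.* fromℕ (v i)) a))
        (subst (ℚ._≤ minDist v t) (sym (proj₂ (minDist-attained v (ℤ.suc k / Q)))) fq≤ft)
        (ℚ.≤-trans (minDist-≤ v t j) (distℚ-nearest (t ℚ.* fromℕ (v j)) b))

      scale : ∀ i → (i / Q) ℚ.* fromℕ s ℚ.* fromℕ n ≡ fromℤ i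
      scale i = trans (ℚ.*-assoc (i / Q) (fromℕ s) (fromℕ n))
        (trans (cong ((i / Q) ℚ.*_) (trans (ℚ.*-comm (fromℕ s) (fromℕ n))
            (trans (sym (fromℕ-* n s)) (cong fromℕ (sym Q≡n*s)))))
          (/-cancelʳ i Q))

      c : ℤ
      c = (a ℤ.+ b) ℤ.* + n

      k<c : k ℤ.< c
      k<c = fromℤ-cancel-< (subst₂ ℚ._<_ (scale k) (sym (fromℤ-* (a ℤ.+ b) (+ n)))
        (ℚ.*-monoˡ-<-pos (fromℕ n) {{fromℕ-pos n}} (proj₁ trapped)))

      c<1+k : c ℤ.< ℤ.suc k
      c<1+k = fromℤ-cancel-< (subst₂ ℚ._<_ (sym (fromℤ-* (a ℤ.+ b) (+ n))) (scale (ℤ.suc k))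
        (ℚ.*-monoˡ-<-pos (fromℕ n) {{fromℕ-pos n}} (proj₂ trapped)))

    abstract
      optimum : ∃[ r ] (∀ j → j ℕ.≤ Q → minDist v (+ j / Q) ℚ.≤ minDist v (+ r / Q))
      optimum = argmax (λ j → minDist v (+ j / Q)) Q

    k₀ : ℤ
    k₀ = + proj₁ optimum

    t₀ : ℚ
    t₀ = k₀ / Q

    grid-≤ : ∀ k → minDist v (k / Q) ℚ.≤ minDist v t₀
    grid-≤ k = ℚ.≤-trans
      (subst (λ t → minDist v t ℚ.≤ minDist v (+ (k ℤ.%ℕ Q) / Q)) (sym (/-mod k))
        (minDist-periodic v (+ (k ℤ.%ℕ Q) / Q) (k ℤ./ℕ Q)))
      (proj₂ optimum (k ℤ.%ℕ Q) (ℕ.<⇒≤ (ℤ.n%ℕd<d k Q)))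

    -- Both ends of the cell are at most the grid maximum, so reaching it inside would contradict
    -- `off-grid`. The strictness later keeps the extended maxima below `M`.
    off-grid-< : ∀ k {t} → k / Q ℚ.< t → t ℚ.< ℤ.suc k / Q → minDist v t ℚ.< minDist v t₀
    off-grid-< k p<t t<q = ℚ.≰⇒> λ max≤ft → off-grid k p<t t<q
      (ℚ.≤-trans (grid-≤ k) max≤ft , ℚ.≤-trans (grid-≤ (ℤ.suc k)) max≤ft)

    maximal : ∀ t → minDist v t ℚ.≤ minDist v t₀
    maximal t =
      [ (λ (k , t≡k/Q) → subst (λ x → minDist v x ℚ.≤ minDist v t₀) (sym t≡k/Q) (grid-≤ k))
      , (λ (k , p<t , t<q) → ℚ.<⇒≤ (off-grid-< k p<t t<q))
      ]′ (locate t)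

    -- At the midpoint `1/(2Q)` of the first cell the value is nonnegative and, being off the grid,
    -- strictly below the maximum.
    maximum-pos : 0ℚ ℚ.< minDist v t₀
    maximum-pos = ℚ.≤-<-trans (0≤minDist v t) (off-grid-< (+ 0) (/-<-intro (+ 0) t 0<tQ) (<-/-intro t (+ 1) tQ<1))
      where
      t = ½ ℚ.* (+ 1 / Q)

      tQ≡½ : t ℚ.* fromℕ Q ≡ ½
      tQ≡½ = trans (ℚ.*-assoc ½ (+ 1 / Q) (fromℕ Q)) (cong (½ ℚ.*_) (/-cancelʳ (+ 1) Q))

      0<tQ : fromℤ (+ 0) ℚ.< t ℚ.* fromℕ Q
      0<tQ = subst (0ℚ ℚ.<_) (sym tQ≡½) (ℚ.positive⁻¹ ½)

      tQ<1 : t ℚ.* fromℕ Q ℚ.< fromℤ (+ 1)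
      tQ<1 = subst (ℚ._< 1ℚ) (sym tQ≡½) (ℚ.*<* (ℤ.+<+ (s≤s (s≤s z≤n))))

-- A common multiple of the pairwise sums of speeds.

upper-bound : ∀ {m} (v : Fin m → ℕ) → ∃[ B ] (∀ i → v i ℕ.≤ B)
upper-bound {zero}  v = 0 , λ ()
upper-bound {suc m} v with upper-bound (v ∘ suc)
... | B , bound = v zero ℕ.⊔ B , λ
  { zero    → ℕ.m≤m⊔n (v zero) B
  ; (suc i) → ℕ.≤-trans (bound i) (ℕ.m≤n⊔m (v zero) B) }

m∣m! : ∀ m .{{_ : ℕ.NonZero m}} → m ∣ m ℕ.!
m∣m! (suc m) = m∣m*n (m ℕ.!)

record CommonMultiple {m} (v : Fin m → ℕ) : Set where
  field
    Q     : ℕ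
    Q≢0   : ℕ.NonZero Q
    v+v∣Q : ∀ i j → v i ℕ.+ v j ∣ Q

-- Abstract, lest the type checker evaluate the factorial or search the grid.
abstract
  commonMultiple : ∀ {m} (v : Fin m → ℕ) → (∀ i → 0 ℕ.< v i) → CommonMultiple v
  commonMultiple v v>0 with upper-bound v
  ... | B , v≤B = record
    -- Every sum `v i + v j` is positive and at most `2B`, hence divides `(2B)!`.
    { Q     = (B ℕ.+ B) ℕ.!
    ; Q≢0   = (B ℕ.+ B) ℕ.!≢0
    ; v+v∣Q = λ i j → ∣-trans
        (m∣m! (v i ℕ.+ v j) {{ℕ.>-nonZero (ℕ.≤-trans (v>0 i) (ℕ.m≤m+n (v i) (v j)))}})
        (m≤n⇒m!∣n! (ℕ.+-mono-≤ (v≤B i) (v≤B j)))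
    }

abstract
  -- Hides the grid of the tuple: an extended tuple contributes only a rational maximiser, which is
  -- then located on the grid of the original tuple.
  maxTime : ∀ {m} (v : Fin (suc m) → ℕ) → (∀ i → 0 ℕ.< v i) →
    ∃[ s ] (∀ t → minDist v t ℚ.≤ minDist v s)
  maxTime v v>0 = t₀ , maximal
    where
    open CommonMultiple (commonMultiple v v>0)
    open Grid Q {{Q≢0}}
    open Maximum v v>0 v+v∣Q

-- From rational times to real times.

seq-minimum : ∀ {m} (v : Fin (suc m) → ℕ) t n →
  seq (minimum (λ i → ‖ t · v i ‖)) n ≡ minDist v (seq t n)
seq-minimum {zero}  v t n = refl
seq-minimum {suc m} v t n =
  cong (distℚ (seq t n ℚ.* fromℕ (v zero)) ℚ.⊓_) (seq-minimum (v ∘ suc) t n)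

p<p+ε : ∀ p {ε} → 0ℚ ℚ.< ε → p ℚ.< p ℚ.+ ε
p<p+ε p {ε} 0<ε = subst (ℚ._< p ℚ.+ ε) (ℚ.+-identityʳ p) (ℚ.+-monoʳ-< p 0<ε)

module _ {m} {v : Fin (suc m) → ℕ} {s : ℚ} (max : ∀ t → minDist v t ℚ.≤ minDist v s) where

  -- Each approximation of a real time is a rational time, so `max` bounds the objective termwise;
  -- the constant time `s` attains the bound.
  isML : IsML v (fromℚ (minDist v s))
  isML =
    (fromℚ s , λ ε 0<ε → 0 , λ n _ → subst (ℚ._< ε)
      (cong ℚ.∣_∣ (sym (trans (cong (ℚ._- minDist v s) (seq-minimum v (fromℚ s) n))
        (ℚ.+-inverseʳ (minDist v s))))) 0<ε) ,
    (λ t ε 0<ε → 0 , λ n _ → ℚ.≤-<-trans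
      (subst (ℚ._≤ minDist v s) (sym (seq-minimum v t n)) (max (seq t n)))
      (p<p+ε (minDist v s) 0<ε))

  -- `A` bounds the value at time `s` from above, and is the limit of values at its own maximising
  -- time, each at most `minDist v s`.
  isML-unique : ∀ {A} → IsML v A → ∀ ε → 0ℚ ℚ.< ε →
    Eventually (λ n → minDist v s ℚ.< seq A n ℚ.+ ε × seq A n ℚ.< minDist v s ℚ.+ ε)
  isML-unique {A} ((t , ft≃A) , f≤A) ε 0<ε = N₁ ℕ.⊔ N₂ , λ n le →
    subst (ℚ._< seq A n ℚ.+ ε) (seq-minimum v (fromℚ s) n)
      (proj₂ (f≤A (fromℚ s) ε 0<ε) n (ℕ.m⊔n≤o⇒n≤o N₁ N₂ le)) ,
    ℚ.≤-<-trans (p≤q+∣p-q∣ (seq A n) (seq ft n))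
      (ℚ.+-mono-≤-< (subst (ℚ._≤ minDist v s) (sym (seq-minimum v t n)) (max (seq t n)))
        (subst (ℚ._< ε) (∣p-q∣≡∣q-p∣ (seq ft n) (seq A n))
          (proj₂ (ft≃A ε 0<ε) n (ℕ.m⊔n≤o⇒m≤o N₁ N₂ le))))
    where
    ft = minimum (λ i → ‖ t · v i ‖)
    N₁ = proj₁ (ft≃A ε 0<ε)
    N₂ = proj₁ (f≤A (fromℚ s) ε 0<ε)

-- Rational sequences converging from below.

module _ {A : ℝ} {M : ℚ} {a : ℕ → ℚ}
  (near : ∀ ε → 0ℚ ℚ.< ε → Eventually (λ n → M ℚ.< seq A n ℚ.+ ε × seq A n ℚ.< M ℚ.+ ε))
  (a<M : ∀ k → a k ℚ.< M) where

  fromℚ-< : ∀ k → fromℚ (a k) < A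
  fromℚ-< k = δ , 0<δ , proj₁ (near δ 0<δ) , λ n le → subst₂ ℚ._<_
      (trans (cong (ℚ._- δ) (trans (solve 2 (λ x y → x := y :+ (x :- y)) refl M (a k))
          (cong (a k ℚ.+_) (sym (half+half (M ℚ.- a k))))))
        (solve 2 (λ x y → x :+ (y :+ y) :- y := x :+ y) refl (a k) δ))
      (solve 2 (λ x y → x :+ y :- y := x) refl (seq A n) δ)
      (ℚ.+-monoˡ-< (ℚ.- δ) (proj₁ (proj₂ (near δ 0<δ) n le)))
    where
    -- Half of the gap absorbs the error between `M` and `A`; the other half is the margin demanded
    -- by `_<_`.
    δ = ½ ℚ.* (M ℚ.- a k)

    0<δ : 0ℚ ℚ.< δ
    0<δ = 0<half (subst (ℚ._< M ℚ.- a k) (ℚ.+-inverseʳ (a k))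
      (ℚ.+-monoˡ-< (ℚ.- a k) (a<M k)))

  -- The hypothesis expresses the rate `M - a k ≤ 1/(k + 1)` without division.
  fromℚ-⟶ : (∀ k ε → 1ℚ ℚ.≤ ε ℚ.* fromℕ (suc k) → M ℚ.≤ a k ℚ.+ ε) → (λ k → fromℚ (a k)) ⟶ A
  fromℚ-⟶ M≤a+ε ε 0<ε = K , λ k K≤k → δ , 0<δ , proj₁ (near δ 0<δ) , λ n le →
    let M<A+δ , A<M+δ = proj₂ (near δ 0<δ) n le
        M≤a+δ = M≤a+ε k δ (ℚ.≤-trans 1≤δK
          (ℚ.*-monoˡ-≤-nonNeg δ {{ℚ.nonNegative (ℚ.<⇒≤ 0<δ)}} (fromℕ-mono {suc K} {suc k} (s≤s K≤k))))
        a≤A+2δ = ℚ.≤-trans (ℚ.<⇒≤ (ℚ.<-trans (a<M k) M<A+δ))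
          (ℚ.+-monoʳ-≤ (seq A n) (ℚ.<⇒≤ (p<p+ε δ 0<δ)))
        A≤a+2δ = subst (seq A n ℚ.≤_) (ℚ.+-assoc (a k) δ δ)
          (ℚ.≤-trans (ℚ.<⇒≤ A<M+δ) (ℚ.+-monoˡ-≤ δ M≤a+δ))
    in ℚ.≤-<-trans (ℚ.+-monoˡ-≤ δ (∣-∣-bound a≤A+2δ A≤a+2δ))
         (subst (δ ℚ.+ δ ℚ.+ δ ℚ.<_) 4δ≡ε (p<p+ε (δ ℚ.+ δ ℚ.+ δ) 0<δ))
    where
    -- Of the four quarters, one covers `M` against `a k`, one `A` against `M`, one is the margin in
    -- `_<_`, and one gives strictness.
    δ = ½ ℚ.* (½ ℚ.* ε)

    0<δ : 0ℚ ℚ.< δ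
    0<δ = 0<half (0<half 0<ε)

    4δ≡ε : δ ℚ.+ δ ℚ.+ δ ℚ.+ δ ≡ ε
    4δ≡ε = trans (ℚ.+-assoc (δ ℚ.+ δ) δ δ)
      (trans (cong₂ ℚ._+_ (half+half (½ ℚ.* ε)) (half+half (½ ℚ.* ε))) (half+half ε))

    K = proj₁ (archimedean δ 0<δ)
    1≤δK = proj₂ (archimedean δ 0<δ)

-- Adding a fast runner.

module Extension {m} (v : Fin (suc m) → ℕ) (v>0 : ∀ i → 0 ℕ.< v i) where

  open CommonMultiple (commonMultiple v v>0)
  open Grid Q {{Q≢0}}
  open Maximum v v>0 v+v∣Q public

  private instance
    Q-nonZero : ℕ.NonZero Q
    Q-nonZero = Q≢0

  M : ℚ
  M = minDist v t₀

  V : ℕ → ℕ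
  V k = suc k ℕ.* Q

  V≢0 : ∀ k → ℕ.NonZero (V k)
  V≢0 k = ℕ.m*n≢0 (suc k) Q

  extended : ℕ → Fin (suc (suc m)) → ℕ
  extended k = V k ∷ v

  extended>0 : ∀ k i → 0 ℕ.< extended k i
  extended>0 k zero    = ℕ.>-nonZero⁻¹ (V k) {{V≢0 k}}
  extended>0 k (suc i) = v>0 i

  s : ℕ → ℚ
  s k = proj₁ (maxTime (extended k) (extended>0 k))

  s-max : ∀ k t → minDist (extended k) t ℚ.≤ minDist (extended k) (s k)
  s-max k = proj₂ (maxTime (extended k) (extended>0 k))

  value : ℕ → ℚ
  value k = minDist (extended k) (s k)

  -- The new maximiser is located on the grid of `v`: on the grid the new runner is at distance 0,
  -- below `M > 0`; off it the old runners already fall short of `M`.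
  value<M : ∀ k → value k ℚ.< M
  value<M k = [ on-grid , off-grid′ ]′ (locate (s k))
    where
    on-grid : ∃[ j ] s k ≡ j / Q → value k ℚ.< M
    on-grid (j , eq) = ℚ.≤-<-trans (minDist-≤ (extended k) (s k) zero)
      (ℚ.≤-<-trans
        (subst (λ x → distℚ x ℚ.≤ 0ℚ)
          (sym (trans (cong (ℚ._* fromℕ (V k)) eq) (multiple-integral j (suc k))))
          (distℚ-fromℤ (j ℤ.* + suc k)))
        maximum-pos)

    off-grid′ : ∃[ j ] (j / Q ℚ.< s k × s k ℚ.< ℤ.suc j / Q) → value k ℚ.< M
    off-grid′ (j , p<s , s<q) = ℚ.≤-<-trans
      (ℚ.p⊓q≤q (distℚ (s k ℚ.* fromℕ (V k))) (minDist v (s k))) (off-grid-< j p<s s<q)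

  -- Delaying t₀ by 1 / (2 V k) brings the new runner to the antipodal point
  -- and moves every other runner by at most 1 / (2 (k + 1)).
  M≤value+δ : ∀ k δ → 1ℚ ℚ.≤ δ ℚ.* fromℕ (suc k) → M ℚ.≤ value k ℚ.+ δ
  M≤value+δ k δ 1≤δk = subst (ℚ._≤ value k ℚ.+ δ) (solve 2 (λ x y → x :- y :+ y := x) refl M δ)
    (ℚ.+-monoˡ-≤ δ (ℚ.≤-trans (minDist-glb (extended k) t bound) (s-max k t)))
    where
    instance
      V-nonZero : ℕ.NonZero (V k)
      V-nonZero = V≢0 k

      k-pos : ℚ.Positive (fromℕ (suc k))
      k-pos = fromℕ-pos (suc k)

    h = ½ ℚ.* (+ 1 / V k)
    t = t₀ ℚ.+ h

    hV≡½ : h ℚ.* fromℕ (V k) ≡ ½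
    hV≡½ = trans (ℚ.*-assoc ½ (+ 1 / V k) (fromℕ (V k))) (cong (½ ℚ.*_) (/-cancelʳ (+ 1) (V k)))

    0≤h : 0ℚ ℚ.≤ h
    0≤h = ℚ.*-cancelʳ-≤-pos (fromℕ (V k)) {{fromℕ-pos (V k)}}
      (subst₂ ℚ._≤_ (sym (ℚ.*-zeroˡ (fromℕ (V k)))) (sym hV≡½) (ℚ.<⇒≤ (ℚ.positive⁻¹ ½)))

    -- After multiplication by `k + 1` this reads `h * V k = ½ ≤ 1 ≤ δ * (k + 1)`.
    hQ≤δ : h ℚ.* fromℕ Q ℚ.≤ δ
    hQ≤δ = ℚ.*-cancelʳ-≤-pos (fromℕ (suc k)) (ℚ.≤-trans
      (ℚ.≤-reflexive (trans (trans (ℚ.*-assoc h (fromℕ Q) (fromℕ (suc k)))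
        (cong (h ℚ.*_) (trans (ℚ.*-comm (fromℕ Q) (fromℕ (suc k))) (sym (fromℕ-* (suc k) Q))))) hV≡½))
      (ℚ.≤-trans (ℚ.*≤* (ℤ.+≤+ (s≤s z≤n))) 1≤δk))

    0≤δ : 0ℚ ℚ.≤ δ
    0≤δ = ℚ.*-cancelʳ-≤-pos (fromℕ (suc k)) (subst (ℚ._≤ δ ℚ.* fromℕ (suc k))
      (sym (ℚ.*-zeroˡ (fromℕ (suc k)))) (ℚ.≤-trans (ℚ.<⇒≤ (ℚ.positive⁻¹ 1ℚ)) 1≤δk))

    shift≤δ : ∀ i → ℚ.∣ t₀ ℚ.* fromℕ (v i) ℚ.- t ℚ.* fromℕ (v i) ∣ ℚ.≤ δ
    shift≤δ i = subst (ℚ._≤ δ)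
      (sym (trans (trans (∣p-q∣≡∣q-p∣ (t₀ ℚ.* fromℕ (v i)) (t ℚ.* fromℕ (v i)))
        (cong ℚ.∣_∣ (solve 3 (λ x y z → (x :+ y) :* z :- x :* z := y :* z) refl t₀ h (fromℕ (v i)))))
        (ℚ.0≤p⇒∣p∣≡p (subst (ℚ._≤ h ℚ.* fromℕ (v i)) (ℚ.*-zeroʳ h) (h*-mono (fromℕ-mono {0} {v i} z≤n))))))
      -- The diagonal case of `v+v∣Q` gives `v i ≤ v i + v i ≤ Q`, so the one bound on `h * Q`
      -- serves every old runner.
      (ℚ.≤-trans (h*-mono (fromℕ-mono {v i} {Q} (ℕ.≤-trans (ℕ.m≤m+n (v i) (v i)) (∣⇒≤ (v+v∣Q i i))))) hQ≤δ)
      where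
      h*-mono : ∀ {x y} → x ℚ.≤ y → h ℚ.* x ℚ.≤ h ℚ.* y
      h*-mono = ℚ.*-monoˡ-≤-nonNeg h {{ℚ.nonNegative 0≤h}}

    -δ : ∀ {x y} → x ℚ.≤ y ℚ.+ δ → x ℚ.- δ ℚ.≤ y
    -δ {x} {y} le = p≤q+r⇒p-q≤r (subst (x ℚ.≤_) (ℚ.+-comm y δ) le)

    bound : ∀ i → M ℚ.- δ ℚ.≤ distℚ (t ℚ.* fromℕ (extended k i))
    -- Here `t * V k = k₀ * (k + 1) + ½` is a half-integer, while `M ≤ ½`.
    bound zero = ℚ.≤-trans
      (-δ (ℚ.≤-trans (minDist≤½ v t₀) (subst (ℚ._≤ ½ ℚ.+ δ) (ℚ.+-identityʳ ½) (ℚ.+-monoʳ-≤ ½ 0≤δ))))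
      (subst (λ x → ½ ℚ.≤ distℚ x)
        (sym (trans (ℚ.*-distribʳ-+ (fromℕ (V k)) t₀ h) (cong₂ ℚ._+_ (multiple-integral k₀ (suc k)) hV≡½)))
        (distℚ-half-integer (k₀ ℤ.* + suc k)))
    bound (suc i) = -δ (ℚ.≤-trans (minDist-≤ v t₀ i)
      (ℚ.≤-trans (distℚ-step (t₀ ℚ.* fromℕ (v i)) (t ℚ.* fromℕ (v i)))
        (ℚ.+-monoʳ-≤ (distℚ (t ℚ.* fromℕ (v i))) (shift≤δ i))))

theorem9p5 : (n : ℕ) → 2 ≤ℕ n → 𝒮 (n ∸ 1) ⊆ LowerAccumulationPoint n
theorem9p5 (suc zero) (s≤s ())
theorem9p5 (suc (suc m)) _ {A} (v , v>0 , A-isML) =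
  (λ k → fromℚ (value k)) ,
  (λ k → extended k , extended>0 k , isML {v = extended k} {s k} (s-max k)) ,
  fromℚ-< {A} near value<M ,
  fromℚ-⟶ {A} near value<M M≤value+δ
  where
  open Extension v v>0

  -- The given `A` is any real satisfying `IsML`; uniqueness of the maximum ties it to the rational
  -- `M`.
  near : ∀ ε → 0ℚ ℚ.< ε → Eventually (λ n → M ℚ.< seq A n ℚ.+ ε × seq A n ℚ.< M ℚ.+ ε)
  near = isML-unique {v = v} {t₀} maximal {A} A-isML
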